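{- $\mathrm{OSGMC}\le\mathrm{MTL}$ over the class of all Kripke trees; that is, for every finite set $AP$, every sentence of the one-step fragment of the graded $\mu$-calculus over $AP$ has an equivalent MTL sentence over $AP$.
   Context: Trees. A tree $T$ is a subset of $\mathbb{N}^*$ (finite words over the naturals) with an element $\tau_0\in T$ (the root) such that every $\tau\in T$ has the form $\tau_0\cdot\tau'$ with $\tau'\in\mathbb{N}^*$, and whenever $\tau_0\cdot\tau\in T$ and $\tau'$ is a prefix of $\tau$, also $\tau_0\cdot\tau'\in T$. Elements of $T$ are nodes. A child of $\tau$ in $T$ is a node of $T$ of the form $\tau\cdot n$, $n\in\mathbb{N}$; a descendant of $\tau$ in $T$ is a node of $T$ of the form $\tau\cdot\tau'$, $\tau'\in\mathbb{N}^*$ (so $\tau$ is a descendant of itself). A subtree of $T$ is a subset of $T$ that is a tree (with any root). $T$ is non-blocking if every node has a child in $T$. For a finite set $AP$ of atomic propositions, a Kripke tree over $AP$ is a pair $(T,\mathrm{Lab})$ with $T$ a non-blocking tree and $\mathrm{Lab}:T\to 2^{AP}$. MTL (monadic tree logic). Formulas over $AP$: $\varphi ::= P_a(x)\mid x\le y\mid x\in X\mid \neg\varphi\mid\varphi\wedge\varphi\mid\exists x.\varphi\mid\exists^{\mathrm{t}}X.\varphi$, with $a\in AP$. First-order variables range over nodes of $T$, second-order variables over subtrees (finite or infinite) of $T$; $P_a(x)$ holds iff $a\in\mathrm{Lab}(x)$; $x\le y$ holds iff $y$ is a descendant of $x$; $x\in X$ is membership. Sentences are formulas without free variables. OSGMC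 (one-step fragment of the graded $\mu$-calculus). Let $\mathrm{Var}$ be a set of fixpoint variables. For $Z,O\subseteq\mathrm{Var}$, base formulas $\varphi_{Z,O}$ and fixpoint formulas $\vartheta_{Z,O}$ are given by $\varphi_{Z,O} ::= \bot\mid\top\mid a\mid\neg\varphi_{Z,O}\mid\varphi_{Z,O}\wedge\varphi_{Z,O}\mid\varphi_{Z,O}\vee\varphi_{Z,O}\mid\Diamond^{\ge k}\varphi_{O,\emptyset}\mid\Box^{<k}\varphi_{O,\emptyset}\mid X\mid\vartheta_{\emptyset,\emptyset}$ (with $a\in AP$, $k\in\mathbb{N}$, $X\in Z$), and $\vartheta_{Z,O} ::= \mu X.\vartheta_{Z\cup\{X\},O\cup\{X\}}\mid\nu X.\vartheta_{Z\cup\{X\},O\cup\{X\}}\mid\varphi_{Z,O}$ (with $X\in\mathrm{Var}$), where every occurrence of a variable must be positive (under an even number of negations). The sentences of OSGMC are the formulas of the form $\vartheta_{\emptyset,\emptyset}$. Given a Kripke tree $\mathcal{T}=(T,\mathrm{Lab})$ and an assignment $\chi$ of subsets of $T$ to variables, the denotation $[\![\vartheta]\!]^{\mathcal T}_{\chi}\subseteq T$ is standard: $[\![a]\!]=\{w: a\in\mathrm{Lab}(w)\}$, $[\![X]\!]_\chi=\chi(X)$, Boolean connectives as set operations, $[\![\Diamond^{\ge k}\varphi]\!]_\chi=\{w\in T: |\mathrm{post}(w)\cap[\![\varphi]\!]_\chi|\ge k\}$, $[\![\Box^{<k}\varphi]\!]_\chi=\{w\in T:|\mathrm{post}(w)\setminus[\![\varphi]\!]_\chi|<k\}$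 with $\mathrm{post}(w)$ the set of children of $w$, $[\![\mu X.\vartheta]\!]_\chi=\bigcap\{W\subseteq T:[\![\vartheta]\!]_{\chi[X\mapsto W]}\subseteq W\}$, $[\![\nu X.\vartheta]\!]_\chi=\bigcup\{W\subseteq T: W\subseteq[\![\vartheta]\!]_{\chi[X\mapsto W]}\}$. A Kripke tree satisfies a sentence if its root belongs to the denotation of the sentence. Two sentences over $AP$ are equivalent if they are satisfied by the same Kripke trees over $AP$. -}

module Defs where

open import Data.Fin.Base using (Fin)
open import Data.List.Base using (List; []; _∷ʳ_; _++_)
open import Data.Nat.Base using (ℕ; zero; suc)
open import Data.Product.Base using (Σ; _×_; ∃)
import Data.Empty.Polymorphic as Poly
open import Data.Sign.Base using (Sign; opposite)
open import Data.Vec.Base using (Vec; []; _∷_; lookup)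
open import Function.Bundles using (_↔_; _⇔_)
open import Function.Definitions using (Injective)
open import Level using (0ℓ; Lift) renaming (suc to lsuc)
open import Relation.Binary.PropositionalEquality.Core using (_≡_)
open import Relation.Nullary.Negation.Core using (¬_)
open import Relation.Unary using (Pred; _∈_; _⊆_; _∩_; _∪_; _∖_)

Finite : Set → Set
Finite A = ∃ λ n → A ↔ Fin n

-- |P| ≥ k; the predicate P may be infinite.
AtLeast : ∀ {a ℓ} {A : Set a} → ℕ → Pred A ℓ → Set _
AtLeast {A = A} k P =
  Σ (Fin k → A) λ f → Injective _≡_ _≡_ f × (∀ i → f i ∈ P)

------------------------------------------------------------------------
-- Trees

Word : Set
Word = List ℕ

infix 4 _⊑_

_⊑_ : Word → Word → Set
τ ⊑ τ′ = ∃ λ σ → τ′ ≡ τ ++ σ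

record IsTree (T : Pred Word 0ℓ) : Set where
  field
    root         : Word
    root∈        : root ∈ T
    rooted       : ∀ {τ} → τ ∈ T → root ⊑ τ
    prefixClosed : ∀ {τ τ′} → root ++ τ ∈ T → τ′ ⊑ τ → root ++ τ′ ∈ T

-- The set post(τ).
Children : Pred Word 0ℓ → Word → Pred Word 0ℓ
Children T τ τ′ = τ′ ∈ T × ∃ λ n → τ′ ≡ τ ∷ʳ n

NonBlocking : Pred Word 0ℓ → Set
NonBlocking T = ∀ {τ} → τ ∈ T → ∃ λ τ′ → τ′ ∈ Children T τ

Subtree : Pred Word 0ℓ → Pred Word 0ℓ → Set
Subtree T S = S ⊆ T × IsTree S

-- Lab is total on words to keep it independent of membership proofs;
-- its values outside T are never consulted.
record KripkeTree (AP : Set) : Set₁ where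
  field
    T           : Pred Word 0ℓ
    isTree      : IsTree T
    nonBlocking : NonBlocking T
    Lab         : Word → Pred AP 0ℓ

  open IsTree isTree public using (root)

------------------------------------------------------------------------
-- Monadic tree logic

module MTL where

  infix  8 _≤_ _∈′_
  infixr 6 _∧_

  -- De Bruijn syntax: m first-order and n second-order variables in scope.
  data Formula (AP : Set) (m n : ℕ) : Set where
    P    : AP → Fin m → Formula AP m n
    _≤_  : Fin m → Fin m → Formula AP m n
    _∈′_ : Fin m → Fin n → Formula AP m n
    neg  : Formula AP m n → Formula AP m n
    _∧_  : Formula AP m n → Formula AP m n → Formula AP m n
    ∃₁   : Formula AP (suc m) n → Formula AP m n
    ∃ᵗ   : Formula AP m (suc n) → Formula AP m n

  Sentence : Set → Set
  Sentence AP = Formula AP 0 0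

  module _ {AP : Set} (𝒯 : KripkeTree AP) where
    open KripkeTree 𝒯

    Sat : ∀ {m n} → Vec Word m → Vec (Pred Word 0ℓ) n → Formula AP m n → Set₁
    Sat ρ σ (P a x)  = Lift _ (a ∈ Lab (lookup ρ x))
    Sat ρ σ (x ≤ y)  = Lift _ (lookup ρ x ⊑ lookup ρ y)
    Sat ρ σ (x ∈′ X) = Lift _ (lookup ρ x ∈ lookup σ X)
    Sat ρ σ (neg φ)  = ¬ Sat ρ σ φ
    Sat ρ σ (φ ∧ ψ)  = Sat ρ σ φ × Sat ρ σ ψ
    Sat ρ σ (∃₁ φ)   = ∃ λ τ → τ ∈ T × Sat (τ ∷ ρ) σ φ
    Sat ρ σ (∃ᵗ φ)   = ∃ λ S → Subtree T S × Sat ρ (S ∷ σ) φ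

  infix 4 _⊨_

  _⊨_ : ∀ {AP} → KripkeTree AP → Sentence AP → Set₁
  𝒯 ⊨ φ = Sat 𝒯 [] [] φ

------------------------------------------------------------------------
-- The one-step fragment of the graded μ-calculus

module OSGMC where

  infixr 6 _∧_
  infixr 5 _∨_

  -- De Bruijn syntax: Z and O are the numbers of variables available here
  -- and below one modality.  A binder extends both scopes by the same
  -- variable, so in subformulas of sentences O is either Z or 0, and an
  -- index has the same meaning in both scopes.
  --
  -- The sign records the parity of the number of negations passed since the
  -- enclosing block of fixpoint binders.  All variables in scope are bound in
  -- that block, so allowing them only at sign + says that they occur
  -- positively in the scope of their binder.
  mutual
    data Base (AP : Set) : Sign → ℕ → ℕ → Set where
      ff     : ∀ {s Z O} → Base AP s Z O
      tt     : ∀ {s Z O} → Base AP s Z O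
      atom   : ∀ {s Z O} → AP → Base AP s Z O
      neg    : ∀ {s Z O} → Base AP (opposite s) Z O → Base AP s Z O
      _∧_    : ∀ {s Z O} → Base AP s Z O → Base AP s Z O → Base AP s Z O
      _∨_    : ∀ {s Z O} → Base AP s Z O → Base AP s Z O → Base AP s Z O
      ◇≥     : ∀ {s Z O} → ℕ → Base AP s O 0 → Base AP s Z O
      □<     : ∀ {s Z O} → ℕ → Base AP s O 0 → Base AP s Z O
      var    : ∀ {Z O} → Fin Z → Base AP Sign.+ Z O
      closed : ∀ {s Z O} → Fix AP 0 0 → Base AP s Z O

    data Fix (AP : Set) (Z O : ℕ) : Set where
      μ    : Fix AP (suc Z) (suc O) → Fix AP Z O
      ν    : Fix AP (suc Z) (suc O) → Fix AP Z O
      base : Base AP Sign.+ Z O → Fix AP Z O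

  Sentence : Set → Set
  Sentence AP = Fix AP 0 0

  module _ {AP : Set} (𝒯 : KripkeTree AP) where
    open KripkeTree 𝒯

    -- Fixpoints quantify over small subsets of T, so denotations are one
    -- level up; under excluded middle at that level each of them is
    -- coextensive with a small subset, so no subset is missed.
    -- The two assignments interpret the scopes Z and O.
    mutual
      ⟦_⟧ : ∀ {s Z O} → Base AP s Z O →
            Vec (Pred Word 0ℓ) Z → Vec (Pred Word 0ℓ) O → Pred Word (lsuc 0ℓ)
      ⟦ ff ⟧       χ ξ = λ _ → Poly.⊥
      ⟦ tt ⟧       χ ξ = λ w → Lift _ (w ∈ T)
      ⟦ atom a ⟧   χ ξ = λ w → Lift _ (w ∈ T × a ∈ Lab w)
      ⟦ neg φ ⟧    χ ξ = T ∖ ⟦ φ ⟧ χ ξ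
      ⟦ φ ∧ ψ ⟧    χ ξ = ⟦ φ ⟧ χ ξ ∩ ⟦ ψ ⟧ χ ξ
      ⟦ φ ∨ ψ ⟧    χ ξ = ⟦ φ ⟧ χ ξ ∪ ⟦ ψ ⟧ χ ξ
      ⟦ ◇≥ k φ ⟧   χ ξ = λ w → w ∈ T × AtLeast k (Children T w ∩ ⟦ φ ⟧ ξ [])
      ⟦ □< k φ ⟧   χ ξ = λ w → w ∈ T × ¬ AtLeast k (Children T w ∖ ⟦ φ ⟧ ξ [])
      ⟦ var X ⟧    χ ξ = λ w → Lift _ (w ∈ lookup χ X)
      ⟦ closed ϑ ⟧ χ ξ = ⟦ ϑ ⟧ᶠ [] []

      ⟦_⟧ᶠ : ∀ {Z O} → Fix AP Z O →
             Vec (Pred Word 0ℓ) Z → Vec (Pred Word 0ℓ) O → Pred Word (lsuc 0ℓ)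
      ⟦ μ ϑ ⟧ᶠ    χ ξ = λ w → (W : Pred Word 0ℓ) → W ⊆ T →
                              ⟦ ϑ ⟧ᶠ (W ∷ χ) (W ∷ ξ) ⊆ W → w ∈ W
      ⟦ ν ϑ ⟧ᶠ    χ ξ = λ w → ∃ λ (W : Pred Word 0ℓ) → W ⊆ T ×
                              W ⊆ ⟦ ϑ ⟧ᶠ (W ∷ χ) (W ∷ ξ) × w ∈ W
      ⟦ base φ ⟧ᶠ χ ξ = ⟦ φ ⟧ χ ξ

  infix 4 _⊨_

  _⊨_ : ∀ {AP} → KripkeTree AP → Sentence AP → Set₁
  𝒯 ⊨ ϑ = KripkeTree.root 𝒯 ∈ ⟦_⟧ᶠ 𝒯 ϑ [] []

------------------------------------------------------------------------

Equivalent : ∀ {AP} → OSGMC.Sentence AP → MTL.Sentence AP → Set₁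
Equivalent {AP} ϑ ψ = (𝒯 : KripkeTree AP) → 𝒯 OSGMC.⊨ ϑ ⇔ 𝒯 MTL.⊨ ψ

{-# OPTIONS --safe #-}

-- All fixpoints of a block σ₁X₁…σₙXₙ.φ denote the same set once the outer
-- variables are set to it: if W = σXᵢ.ϑ, then W is also the denotation of ϑ
-- at Xᵢ = W.  Since φ looks only at a node and its children, the greatest
-- fixpoint W may therefore be cut down to the nodes reachable from x inside
-- W, which form a subtree that is still a post-fixpoint.  Dually, x lies
-- outside a least fixpoint W iff x lies in a subtree whose complement is a
-- pre-fixpoint, and the nodes reachable from x outside W form such a subtree.
-- So νX.ϑ becomes ∃ᵗS. x ∈ S ∧ ∀ y ∈ S. ϑ(y, S), and μX.ϑ becomes
-- ¬∃ᵗS. x ∈ S ∧ ∀ y ∈ S. ¬ϑ(y, T ∖ S).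
module Submission where

open import Defs
open import Axiom.ExcludedMiddle using (ExcludedMiddle)
open import Data.Empty using (⊥-elim)
open import Data.Fin.Base using (Fin; zero; suc)
open import Data.Fin.Properties using (0≢1+n; suc-injective)
open import Data.List.Base using (List; []; _∷_; _∷ʳ_; _++_; map; initLast; _∷ʳ′_)
open import Data.List.Properties
  using (++-assoc; ++-identityʳ; ++-conicalˡ; ++-identityʳ-unique; ∷ʳ-injectiveˡ)
open import Data.List.Relation.Unary.All as All using (All; []; _∷_)
import Data.List.Relation.Unary.All.Properties as All
open import Data.Nat.Base using (ℕ; zero; suc)
open import Data.Product.Base using (_×_; _,_; proj₁; proj₂; ∃)
open import Data.Product.Function.NonDependent.Propositional using (_×-⇔_)
open import Data.Sign.Base using (Sign; opposite)
open import Data.Sum.Base using (_⊎_; inj₁; inj₂; [_,_]′)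
open import Data.Vec.Base as Vec using (Vec; []; _∷_; lookup)
open import Data.Vec.Properties using (map-∘; map-cong; lookup-map)
open import Function.Base using (_∘_; id)
open import Function.Bundles using (_⇔_; mk⇔; Equivalence)
open import Level using (0ℓ; Lift; lift; lower) renaming (suc to lsuc)
open import Relation.Binary.PropositionalEquality
  using (_≡_; _≢_; refl; sym; trans; cong; subst; subst₂)
open import Relation.Nullary.Decidable
  using (Dec; yes; no; True; toWitness; fromWitness; decidable-stable; map′)
open import Relation.Nullary.Negation using (¬_; contradiction)
open import Relation.Unary using (Pred; _∈_; _∉_; _⊆_; _≐_; _∩_; _∪_; _∖_)

open Equivalence using (to; from)

-- The prefix order and convexity of trees.

⊑-refl : ∀ {x} → x ⊑ x
⊑-refl {x} = [] , sym (++-identityʳ x)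

⊑-trans : ∀ {x y z} → x ⊑ y → y ⊑ z → x ⊑ z
⊑-trans {x} (σ , refl) (τ , refl) = σ ++ τ , ++-assoc x σ τ

⊑-antisym : ∀ {x y} → x ⊑ y → y ⊑ x → x ≡ y
⊑-antisym {x} (σ , refl) (τ , eq) =
  sym (trans (cong (x ++_) σ≡[]) (++-identityʳ x))
  where
  σ≡[] : σ ≡ []
  σ≡[] = ++-conicalˡ σ τ (++-identityʳ-unique x (trans eq (++-assoc x σ τ)))

⊑-∷ʳ : ∀ {x n} → x ⊑ x ∷ʳ n
⊑-∷ʳ {n = n} = n ∷ [] , refl

∷ʳ-⋢ : ∀ {x n} → ¬ (x ∷ʳ n ⊑ x)
∷ʳ-⋢ {x} p with ++-identityʳ-unique x (⊑-antisym ⊑-∷ʳ p)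
... | ()

⊑-∷ʳ⁻ : ∀ {x y n} → x ⊑ y ∷ʳ n → x ⊑ y ⊎ x ≡ y ∷ʳ n
⊑-∷ʳ⁻ {x} {y} (σ , eq) with initLast σ
... | []      = inj₂ (sym (trans eq (++-identityʳ x)))
... | τ ∷ʳ′ m = inj₁ (τ , ∷ʳ-injectiveˡ y (x ++ τ) (trans eq (sym (++-assoc x τ (m ∷ [])))))

-- `prefixClosed` speaks only of words spelled `root ++ _`. Since `x` extends the root, so do `y`
-- and `z`, and reassociating the concatenations gives them that form.
convex : ∀ {T} → IsTree T → ∀ {x y z} → x ∈ T → z ∈ T → x ⊑ y → y ⊑ z → y ∈ T
convex {T} tree {z = z} x∈T z∈T x⊑y (υ , refl) with IsTree.rooted tree x∈T
... | σ , refl with x⊑y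
...   | τ , refl = subst T (sym (++-assoc root σ τ)) (prefixClosed
        (subst T (trans (cong (_++ υ) (++-assoc root σ τ)) (++-assoc root (σ ++ τ) υ)) z∈T)
        (υ , refl))
  where open IsTree tree

-- Counting witnesses.

-- Splits off one witness at a time, to match the recursion of `children≥`.
AtLeast-suc : ∀ {A : Set} {ℓ} {k} {P : Pred A ℓ} →
  (∃ λ a → a ∈ P × AtLeast k (λ b → b ∈ P × b ≢ a)) ⇔ AtLeast (suc k) P
AtLeast-suc {A} {k = k} {P} = mk⇔ forth back
  where
  forth : (∃ λ a → a ∈ P × AtLeast k (λ b → b ∈ P × b ≢ a)) → AtLeast (suc k) P
  forth (a , a∈P , f , inj , f∈) = g , g-inj , g∈
    where
    g : Fin (suc k) → A
    g zero    = a
    g (suc i) = f i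

    g-inj : ∀ {i j} → g i ≡ g j → i ≡ j
    g-inj {zero}  {zero}  _  = refl
    g-inj {zero}  {suc j} eq = contradiction (sym eq) (proj₂ (f∈ j))
    g-inj {suc i} {zero}  eq = contradiction eq (proj₂ (f∈ i))
    g-inj {suc i} {suc j} eq = cong suc (inj eq)

    g∈ : ∀ i → g i ∈ P
    g∈ zero    = a∈P
    g∈ (suc i) = proj₁ (f∈ i)

  back : AtLeast (suc k) P → ∃ λ a → a ∈ P × AtLeast k (λ b → b ∈ P × b ≢ a)
  back (f , inj , f∈) = f zero , f∈ zero , f ∘ suc , suc-injective ∘ inj ,
    λ i → f∈ (suc i) , λ eq → 0≢1+n (sym (inj eq))

AtLeast-map : ∀ {A : Set} {ℓ ℓ′ k} {P : Pred A ℓ} {Q : Pred A ℓ′} →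
  (∀ {a} → a ∈ P → a ∈ Q) → AtLeast k P → AtLeast k Q
AtLeast-map P⊆Q (f , inj , f∈) = f , inj , λ i → P⊆Q (f∈ i)

-- The translation into MTL.

module Translation {AP : Set} where
  open MTL using (Formula; P; ∃₁; ∃ᵗ; _∈′_)
    renaming (neg to ¬ᵐ_; _∧_ to _∧ᵐ_; _≤_ to _≤ᵐ_)
  open OSGMC

  -- With only the descendant order available, a child is a proper descendant with no node strictly
  -- in between.
  child : ∀ {m n} → Fin m → Fin m → Formula AP m n
  child x y = x ≤ᵐ y ∧ᵐ ¬ᵐ (y ≤ᵐ x) ∧ᵐ ¬ᵐ ∃₁
    (suc x ≤ᵐ zero ∧ᵐ ¬ᵐ (zero ≤ᵐ suc x) ∧ᵐ zero ≤ᵐ suc y ∧ᵐ ¬ᵐ (suc y ≤ᵐ zero))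

  -- Equality is expressed by antisymmetry of the order; `y ≤ᵐ y` stands for truth.
  distinctFrom : ∀ {m n} → Fin m → List (Fin m) → Formula AP m n
  distinctFrom y []       = y ≤ᵐ y
  distinctFrom y (z ∷ zs) = ¬ᵐ (y ≤ᵐ z ∧ᵐ z ≤ᵐ y) ∧ᵐ distinctFrom y zs

  -- The list `ys` holds the children already chosen. Taking `φ` polymorphic in `m` lets it be
  -- instantiated under each new quantifier without renaming formulas.
  children≥ : ∀ {m n} → ℕ → Fin m → List (Fin m) →
              (∀ {m} → Fin m → Formula AP m n) → Formula AP m n
  children≥ zero    x ys φ = x ≤ᵐ x
  children≥ (suc k) x ys φ = ∃₁ (child (suc x) zero ∧ᵐ φ zero ∧ᵐ
    distinctFrom zero (map suc ys) ∧ᵐ children≥ k (suc x) (zero ∷ map suc ys) φ)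

  -- The set named by (Sign.- , X) is the complement of X.
  SetVar : ℕ → Set
  SetVar n = Sign × Fin n

  weaken : ∀ {n} → SetVar n → SetVar (suc n)
  weaken (s , X) = s , suc X

  member : ∀ {m n} → Fin m → SetVar n → Formula AP m n
  member x (Sign.+ , X) = x ∈′ X
  member x (Sign.- , X) = ¬ᵐ (x ∈′ X)

  mutual
    translate : ∀ {s Z O m n} → Base AP s Z O → Fin m →
                Vec (SetVar n) Z → Vec (SetVar n) O → Formula AP m n
    translate ff         x χ ξ = ¬ᵐ (x ≤ᵐ x)
    translate tt         x χ ξ = x ≤ᵐ x
    translate (atom a)   x χ ξ = P a x
    translate (neg φ)    x χ ξ = ¬ᵐ translate φ x χ ξ
    translate (φ ∧ ψ)    x χ ξ = translate φ x χ ξ ∧ᵐ translate ψ x χ ξ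
    translate (φ ∨ ψ)    x χ ξ = ¬ᵐ (¬ᵐ translate φ x χ ξ ∧ᵐ ¬ᵐ translate ψ x χ ξ)
    translate (◇≥ k φ)   x χ ξ = children≥ k x [] λ y → translate φ y ξ []
    translate (□< k φ)   x χ ξ = ¬ᵐ children≥ k x [] λ y → ¬ᵐ translate φ y ξ []
    translate (var X)    x χ ξ = member x (lookup χ X)
    translate (closed ϑ) x χ ξ = translateᶠ ϑ x [] []

    translateᶠ : ∀ {Z O m n} → Fix AP Z O → Fin m →
                 Vec (SetVar n) Z → Vec (SetVar n) O → Formula AP m n
    translateᶠ (μ ϑ) x χ ξ = ¬ᵐ ∃ᵗ (x ∈′ zero ∧ᵐ ¬ᵐ ∃₁ (zero ∈′ zero ∧ᵐ
      translateᶠ ϑ zero ((Sign.- , zero) ∷ Vec.map weaken χ) ((Sign.- , zero) ∷ Vec.map weaken ξ)))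
    translateᶠ (ν ϑ) x χ ξ = ∃ᵗ (x ∈′ zero ∧ᵐ ¬ᵐ ∃₁ (zero ∈′ zero ∧ᵐ
      ¬ᵐ translateᶠ ϑ zero ((Sign.+ , zero) ∷ Vec.map weaken χ) ((Sign.+ , zero) ∷ Vec.map weaken ξ)))
    translateᶠ (base φ) x χ ξ = translate φ x χ ξ

  -- A sentence has no free variable for the root, so the root is defined as the node of which every
  -- node is a descendant.
  translateSentence : Sentence AP → MTL.Sentence AP
  translateSentence ϑ =
    ∃₁ (¬ᵐ ∃₁ (¬ᵐ (suc zero ≤ᵐ zero)) ∧ᵐ translateᶠ ϑ zero [] [])

-- Locality and monotonicity of denotations.

module Semantics (em : ExcludedMiddle (lsuc 0ℓ)) {AP : Set} (𝒯 : KripkeTree AP) where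
  open KripkeTree 𝒯
  open OSGMC


  decide : (A : Set) → Dec A
  decide A = map′ lower lift (em {Lift (lsuc 0ℓ) A})

  -- Fixpoints range over small sets while denotations live one level up; excluded middle brings a
  -- denotation back down, so that it can serve as a candidate.
  small : Pred Word (lsuc 0ℓ) → Pred Word 0ℓ
  small Q w = True (em {Q w})

  small≐ : ∀ {Q} → Q ≐ small Q
  small≐ = fromWitness , toWitness

  Assignment : ℕ → Set₁
  Assignment = Vec (Pred Word 0ℓ)

  infix 4 _≤[_]_at_ _≤_at_ _≤_

  -- The comparison is made at a single node so that `local-mono` can express how far a one-step
  -- formula looks.
  _≤_at_ : ∀ {n} → Assignment n → Assignment n → Word → Set
  χ ≤ χ′ at w = ∀ i → w ∈ lookup χ i → w ∈ lookup χ′ i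

  _≤_ : ∀ {n} → Assignment n → Assignment n → Set
  χ ≤ χ′ = ∀ {w} → χ ≤ χ′ at w

  _≤[_]_at_ : ∀ {n} → Assignment n → Sign → Assignment n → Word → Set
  χ ≤[ Sign.+ ] χ′ at w = χ ≤ χ′ at w
  χ ≤[ Sign.- ] χ′ at w = χ′ ≤ χ at w

  ≤[]-opposite : ∀ s {n} {χ χ′ : Assignment n} {w} →
                 χ ≤[ s ] χ′ at w → χ′ ≤[ opposite s ] χ at w
  ≤[]-opposite Sign.+ p = p
  ≤[]-opposite Sign.- p = p

  ≤[]-[] : ∀ s {w} → [] ≤[ s ] [] at w
  ≤[]-[] Sign.+ ()
  ≤[]-[] Sign.- ()

  cons-≤ : ∀ {n} {χ χ′ : Assignment n} {V V′ w} →
           (w ∈ V → w ∈ V′) → χ ≤ χ′ at w → (V ∷ χ) ≤ (V′ ∷ χ′) at w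
  cons-≤ p q zero    = p
  cons-≤ p q (suc i) = q i

  infix 4 _⊆ᵀ
  _⊆ᵀ : ∀ {n} → Assignment n → Set
  χ ⊆ᵀ = ∀ i → lookup χ i ⊆ T

  cons-⊆ᵀ : ∀ {n} {χ : Assignment n} {V} → V ⊆ T → χ ⊆ᵀ → (V ∷ χ) ⊆ᵀ
  cons-⊆ᵀ p q zero    = p
  cons-⊆ᵀ p q (suc i) = q i

  -- Below a modality only the scope `ξ` remains, and the next modality has no variables at all.
  -- Hence `χ` matters only at `w` and `ξ` only at its children.
  local-mono : ∀ {s Z O} (φ : Base AP s Z O) {χ χ′ ξ ξ′ w} →
    χ ≤[ s ] χ′ at w → (∀ {c} → c ∈ Children T w → ξ ≤[ s ] ξ′ at c) →
    w ∈ ⟦ 𝒯 ⟧ φ χ ξ → w ∈ ⟦ 𝒯 ⟧ φ χ′ ξ′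
  local-mono tt         p q r              = r
  local-mono (atom a)   p q r              = r
  local-mono {s} (neg φ) p q (w∈T , w∉)    = w∈T , λ r →
    w∉ (local-mono φ (≤[]-opposite s p) (λ c → ≤[]-opposite s (q c)) r)
  local-mono (φ ∧ ψ)    p q (r , r′)       = local-mono φ p q r , local-mono ψ p q r′
  local-mono (φ ∨ ψ)    p q (inj₁ r)       = inj₁ (local-mono φ p q r)
  local-mono (φ ∨ ψ)    p q (inj₂ r)       = inj₂ (local-mono ψ p q r)
  local-mono {s} (◇≥ k φ) p q (w∈T , many) = w∈T ,
    AtLeast-map {P = Children T _ ∩ ⟦ 𝒯 ⟧ φ _ []} {Q = Children T _ ∩ ⟦ 𝒯 ⟧ φ _ []}
      (λ (c , r) → c , local-mono φ (q c) (λ _ → ≤[]-[] s) r) many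
  local-mono {s} (□< k φ) p q (w∈T , few)  = w∈T , λ many → few
    (AtLeast-map {P = Children T _ ∖ ⟦ 𝒯 ⟧ φ _ []} {Q = Children T _ ∖ ⟦ 𝒯 ⟧ φ _ []}
      (λ (c , c∉) → c , λ r → c∉ (local-mono φ (q c) (λ _ → ≤[]-[] s) r)) many)
  local-mono (var X)    p q (lift r)       = lift (p X r)
  local-mono (closed ϑ) p q r              = r

  mono : ∀ {Z O} (ϑ : Fix AP Z O) {χ χ′ ξ ξ′} → χ ≤ χ′ → ξ ≤ ξ′ →
         ⟦ 𝒯 ⟧ᶠ ϑ χ ξ ⊆ ⟦ 𝒯 ⟧ᶠ ϑ χ′ ξ′
  mono (μ ϑ) p q r V V⊆T V-pre = r V V⊆T
    (V-pre ∘ mono ϑ (cons-≤ id p) (cons-≤ id q))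
  mono (ν ϑ) p q (V , V⊆T , V⊆ , w∈V) =
    V , V⊆T , mono ϑ (cons-≤ id p) (cons-≤ id q) ∘ V⊆ , w∈V
  mono (base φ) p q r = local-mono φ p (λ _ → q) r

  mutual
    ⟦⟧⊆T : ∀ {s Z O} (φ : Base AP s Z O) {χ ξ} → χ ⊆ᵀ → ⟦ 𝒯 ⟧ φ χ ξ ⊆ T
    ⟦⟧⊆T tt         p (lift w∈T)     = w∈T
    ⟦⟧⊆T (atom a)   p (lift (w∈T , _)) = w∈T
    ⟦⟧⊆T (neg φ)    p (w∈T , _)      = w∈T
    ⟦⟧⊆T (φ ∧ ψ)    p (r , _)        = ⟦⟧⊆T φ p r
    ⟦⟧⊆T (φ ∨ ψ)    p (inj₁ r)       = ⟦⟧⊆T φ p r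
    ⟦⟧⊆T (φ ∨ ψ)    p (inj₂ r)       = ⟦⟧⊆T ψ p r
    ⟦⟧⊆T (◇≥ k φ)   p (w∈T , _)      = w∈T
    ⟦⟧⊆T (□< k φ)   p (w∈T , _)      = w∈T
    ⟦⟧⊆T (var X)    p (lift r)       = p X r
    ⟦⟧⊆T (closed ϑ) p r              = ⟦⟧ᶠ⊆T ϑ (λ ()) r

    ⟦⟧ᶠ⊆T : ∀ {Z O} (ϑ : Fix AP Z O) {χ ξ} → χ ⊆ᵀ → ⟦ 𝒯 ⟧ᶠ ϑ χ ξ ⊆ T
    ⟦⟧ᶠ⊆T (μ ϑ)    p r                     = r T id (⟦⟧ᶠ⊆T ϑ (cons-⊆ᵀ id p))
    ⟦⟧ᶠ⊆T (ν ϑ)    p (V , V⊆T , _ , w∈V)   = V⊆T w∈V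
    ⟦⟧ᶠ⊆T (base φ) p r                     = ⟦⟧⊆T φ p r

  -- Unfolding and modifying nested fixpoints.

  -- The Knaster-Tarski argument. The conclusion has the same shape as the hypothesis, so it can be
  -- iterated through a block of binders with the same `W`.
  unfold-μ : ∀ {Z O} (ϑ : Fix AP (suc Z) (suc O)) {χ ξ W} → χ ⊆ᵀ →
    ⟦ 𝒯 ⟧ᶠ (μ ϑ) χ ξ ≐ W → ⟦ 𝒯 ⟧ᶠ ϑ (W ∷ χ) (W ∷ ξ) ≐ W
  unfold-μ ϑ {χ} {ξ} {W} p (⊆W , W⊆) = pre , post
    where
    pre : ⟦ 𝒯 ⟧ᶠ ϑ (W ∷ χ) (W ∷ ξ) ⊆ W
    pre r = ⊆W λ V V⊆T V-pre → let W⊆V = λ {w} w∈W → W⊆ {w} w∈W V V⊆T V-pre in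
      V-pre (mono ϑ (cons-≤ W⊆V λ _ → id) (cons-≤ W⊆V λ _ → id) r)

    post : W ⊆ ⟦ 𝒯 ⟧ᶠ ϑ (W ∷ χ) (W ∷ ξ)
    -- The image `V` of `W` lies below `W`, so by monotonicity it is again a pre-fixpoint, and the
    -- least one is contained in it.
    post w∈W = toWitness (W⊆ w∈W V (W⊆T ∘ V⊆W)
      (fromWitness ∘ mono ϑ (cons-≤ V⊆W λ _ → id) (cons-≤ V⊆W λ _ → id)))
      where
      W⊆T : W ⊆ T
      W⊆T = ⟦⟧ᶠ⊆T (μ ϑ) p ∘ W⊆

      V : Pred Word 0ℓ
      V = small (⟦ 𝒯 ⟧ᶠ ϑ (W ∷ χ) (W ∷ ξ))

      V⊆W : ∀ {w} → w ∈ V → w ∈ W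
      V⊆W = pre ∘ toWitness

  unfold-ν : ∀ {Z O} (ϑ : Fix AP (suc Z) (suc O)) {χ ξ W} → χ ⊆ᵀ →
    ⟦ 𝒯 ⟧ᶠ (ν ϑ) χ ξ ≐ W → ⟦ 𝒯 ⟧ᶠ ϑ (W ∷ χ) (W ∷ ξ) ≐ W
  unfold-ν ϑ {χ} {ξ} {W} p (⊆W , W⊆) = pre , post
    where
    W⊆T : W ⊆ T
    W⊆T = ⟦⟧ᶠ⊆T (ν ϑ) p ∘ W⊆

    post : W ⊆ ⟦ 𝒯 ⟧ᶠ ϑ (W ∷ χ) (W ∷ ξ)
    post w∈W with W⊆ w∈W
    ... | V , V⊆T , V⊆ , w∈V = mono ϑ (cons-≤ V⊆W λ _ → id) (cons-≤ V⊆W λ _ → id) (V⊆ w∈V)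
      where
      V⊆W : ∀ {w} → w ∈ V → w ∈ W
      V⊆W v∈V = ⊆W (V , V⊆T , V⊆ , v∈V)

    pre : ⟦ 𝒯 ⟧ᶠ ϑ (W ∷ χ) (W ∷ ξ) ⊆ W
    -- Dually, the image of `W` lies above `W` and is therefore a post-fixpoint.
    pre r = ⊆W (small _ , ⟦⟧ᶠ⊆T ϑ (cons-⊆ᵀ W⊆T p) ∘ toWitness ,
      mono ϑ (cons-≤ (fromWitness ∘ post) λ _ → id)
             (cons-≤ (fromWitness ∘ post) λ _ → id) ∘ toWitness ,
      fromWitness r)

  -- The bound (χ₀ , ξ₀) keeps every inner fixpoint inside W, so a child of a node
  -- of S that lies in one lies in S.  In the recursion the new variable is
  -- bounded by W itself.
  restrict : ∀ {S W : Pred Word 0ℓ} → S ⊆ W →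
    (∀ {v c} → v ∈ S → c ∈ Children T v → c ∈ W → c ∈ S) →
    ∀ {Z O} (ϑ : Fix AP Z O) {χ χ₀ χ′ ξ ξ₀ ξ′} → χ₀ ⊆ᵀ → χ ≤ χ₀ → ξ ≤ ξ₀ →
    ⟦ 𝒯 ⟧ᶠ ϑ χ₀ ξ₀ ≐ W →
    (∀ {v} → v ∈ S → χ ≤ χ′ at v) →
    (∀ {v c} → v ∈ S → c ∈ Children T v → ξ ≤ ξ′ at c) →
    ∀ {v} → v ∈ S → v ∈ ⟦ 𝒯 ⟧ᶠ ϑ χ ξ → v ∈ ⟦ 𝒯 ⟧ᶠ ϑ χ′ ξ′
  restrict S⊆W S-closed (base φ) χ₀⊆T χ≤ ξ≤ eq here below v∈S =
    local-mono φ (here v∈S) (below v∈S)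
  restrict {S} {W} S⊆W S-closed (ν ϑ) χ₀⊆T χ≤ ξ≤ eq here below v∈S (V , V⊆T , V⊆ , v∈V) =
    -- The witness is cut down to `S`. Being a post-fixpoint below the bound, `V` lies in `W`, so
    -- children in `V` of nodes of `S` stay in `S`.
    V ∩ S , V⊆T ∘ proj₁ ,
    (λ (u∈V , u∈S) → restrict S⊆W S-closed ϑ (cons-⊆ᵀ W⊆T χ₀⊆T)
      (cons-≤ V⊆W χ≤) (cons-≤ V⊆W ξ≤) (unfold-ν ϑ χ₀⊆T eq)
      (λ w∈S → cons-≤ (_, w∈S) (here w∈S))
      (λ w∈S c → cons-≤ (λ c∈V → c∈V , S-closed w∈S c (V⊆W c∈V)) (below w∈S c))
      u∈S (V⊆ u∈V)) ,
    v∈V , v∈S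
    where
    W⊆T : W ⊆ T
    W⊆T = ⟦⟧ᶠ⊆T (ν ϑ) χ₀⊆T ∘ proj₂ eq

    V⊆W : V ⊆ W
    V⊆W u∈V = proj₁ eq (mono (ν ϑ) χ≤ ξ≤ (V , V⊆T , V⊆ , u∈V))
  restrict {S} {W} S⊆W S-closed (μ ϑ) {χ} {ξ = ξ} χ₀⊆T χ≤ ξ≤ eq here below v∈S r V V⊆T V-pre =
    [ proj₁ , (λ (_ , v∉S) → contradiction v∈S v∉S) ]′ (r V′ V′⊆T V′-pre)
    where
    W⊆T : W ⊆ T
    W⊆T = ⟦⟧ᶠ⊆T (μ ϑ) χ₀⊆T ∘ proj₂ eq

    V′ : Pred Word 0ℓ
    -- A pre-fixpoint for the unprimed assignments: on `S` it follows `V`, and elsewhere it is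
    -- filled up with the fixed set `W`. No child of a node of `S` falls in the filling.
    V′ = (V ∩ S) ∪ (W ∖ S)

    V′⊆W : V′ ⊆ W
    V′⊆W = [ S⊆W ∘ proj₂ , proj₁ ]′

    V′⊆T : V′ ⊆ T
    V′⊆T = W⊆T ∘ V′⊆W

    V′-pre : ⟦ 𝒯 ⟧ᶠ ϑ (V′ ∷ χ) (V′ ∷ ξ) ⊆ V′
    V′-pre {u} q with decide (u ∈ S)
    ... | no  u∉S = inj₂ (proj₁ (unfold-μ ϑ χ₀⊆T eq)
                            (mono ϑ (cons-≤ V′⊆W χ≤) (cons-≤ V′⊆W ξ≤) q) , u∉S)
    ... | yes u∈S = inj₁ (V-pre (restrict S⊆W S-closed ϑ (cons-⊆ᵀ W⊆T χ₀⊆T)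
      (cons-≤ V′⊆W χ≤) (cons-≤ V′⊆W ξ≤) (unfold-μ ϑ χ₀⊆T eq)
      (λ w∈S → cons-≤ [ proj₁ , (λ (_ , w∉S) → contradiction w∈S w∉S) ]′ (here w∈S))
      (λ w∈S c → cons-≤
        [ proj₁ , (λ (c∈W , c∉S) → contradiction (S-closed w∈S c c∈W) c∉S) ]′ (below w∈S c))
      u∈S q) , u∈S)

  -- The dual of restrict: here (χ₀ , ξ₀) is a lower bound, and a child that
  -- leaves S lies in W and hence in every inner fixpoint.
  extend : ∀ {S W : Pred Word 0ℓ} →
    (∀ {v c} → v ∈ S → c ∈ Children T v → c ∉ S → c ∈ W) →
    ∀ {Z O} (ϑ : Fix AP Z O) {χ χ₀ χ′ ξ ξ₀ ξ′} → χ₀ ⊆ᵀ → χ′ ⊆ᵀ → χ₀ ≤ χ → ξ₀ ≤ ξ →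
    ⟦ 𝒯 ⟧ᶠ ϑ χ₀ ξ₀ ≐ W →
    (∀ {v} → v ∈ S → χ′ ≤ χ at v) →
    (∀ {v c} → v ∈ S → c ∈ Children T v → ξ′ ≤ ξ at c) →
    ∀ {v} → v ∈ S → v ∈ ⟦ 𝒯 ⟧ᶠ ϑ χ′ ξ′ → v ∈ ⟦ 𝒯 ⟧ᶠ ϑ χ ξ
  extend S-closed (base φ) χ₀⊆T χ′⊆T ≤χ ≤ξ eq here below v∈S =
    local-mono φ (here v∈S) (below v∈S)
  extend {S} {W} S-closed (μ ϑ) {χ′ = χ′} {ξ′ = ξ′} χ₀⊆T χ′⊆T ≤χ ≤ξ eq here below v∈S r V V⊆T V-pre =
    [ id , (λ (_ , v∉S) → contradiction v∈S v∉S) ]′ (r V′ V′⊆T V′-pre)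
    where
    W⊆T : W ⊆ T
    W⊆T = ⟦⟧ᶠ⊆T (μ ϑ) χ₀⊆T ∘ proj₂ eq

    W⊆V : W ⊆ V
    W⊆V u∈W = mono (μ ϑ) ≤χ ≤ξ (proj₂ eq u∈W) V V⊆T V-pre

    V′ : Pred Word 0ℓ
    V′ = V ∪ (T ∖ S)

    V′⊆T : V′ ⊆ T
    V′⊆T = [ V⊆T , proj₁ ]′

    V′-pre : ⟦ 𝒯 ⟧ᶠ ϑ (V′ ∷ χ′) (V′ ∷ ξ′) ⊆ V′
    V′-pre {u} q with decide (u ∈ S)
    ... | no  u∉S = inj₂ (⟦⟧ᶠ⊆T ϑ (cons-⊆ᵀ V′⊆T χ′⊆T) q , u∉S)
    ... | yes u∈S = inj₁ (V-pre (extend S-closed ϑ (cons-⊆ᵀ W⊆T χ₀⊆T) (cons-⊆ᵀ V′⊆T χ′⊆T)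
      (cons-≤ W⊆V ≤χ) (cons-≤ W⊆V ≤ξ) (unfold-μ ϑ χ₀⊆T eq)
      (λ w∈S → cons-≤ [ id , (λ (_ , w∉S) → contradiction w∈S w∉S) ]′ (here w∈S))
      (λ w∈S c → cons-≤ [ id , (λ (_ , c∉S) → W⊆V (S-closed w∈S c c∉S)) ]′ (below w∈S c))
      u∈S q))
  extend {S} {W} S-closed (ν ϑ) {χ} {ξ = ξ} χ₀⊆T χ′⊆T ≤χ ≤ξ eq here below v∈S (V , V⊆T , V⊆ , v∈V) =
    V′ , [ V⊆T ∘ proj₁ , W⊆T ]′ , V′⊆ , inj₁ (v∈V , v∈S)
    where
    W⊆T : W ⊆ T
    W⊆T = ⟦⟧ᶠ⊆T (ν ϑ) χ₀⊆T ∘ proj₂ eq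

    V′ : Pred Word 0ℓ
    -- `V` is trusted only on `S`. Adding `W` catches the children that leave `S`, and `W` supports
    -- itself.
    V′ = (V ∩ S) ∪ W

    V′⊆ : V′ ⊆ ⟦ 𝒯 ⟧ᶠ ϑ (V′ ∷ χ) (V′ ∷ ξ)
    V′⊆ (inj₂ u∈W) = mono ϑ (cons-≤ inj₂ ≤χ) (cons-≤ inj₂ ≤ξ) (proj₂ (unfold-ν ϑ χ₀⊆T eq) u∈W)
    V′⊆ (inj₁ (u∈V , u∈S)) = extend S-closed ϑ (cons-⊆ᵀ W⊆T χ₀⊆T) (cons-⊆ᵀ V⊆T χ′⊆T)
      (cons-≤ inj₂ ≤χ) (cons-≤ inj₂ ≤ξ) (unfold-ν ϑ χ₀⊆T eq)
      (λ w∈S → cons-≤ (λ w∈V → inj₁ (w∈V , w∈S)) (here w∈S))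
      (λ w∈S c → cons-≤ (entering w∈S c) (below w∈S c))
      u∈S (V⊆ u∈V)
      where
      entering : ∀ {w c} → w ∈ S → c ∈ Children T w → c ∈ V → c ∈ V′
      entering {c = c} w∈S child c∈V with decide (c ∈ S)
      ... | yes c∈S = inj₁ (c∈V , c∈S)
      ... | no  c∉S = inj₂ (S-closed w∈S child c∉S)

  -- Fixpoints characterized by subtrees.

  -- Reachability from `x` inside `W`, phrased by intermediate prefixes to avoid induction on paths.
  -- Membership in `T` is demanded separately because `W` may be a complement taken among all words.
  Component : Pred Word 0ℓ → Word → Pred Word 0ℓ
  Component W x w = x ⊑ w × w ∈ T × (∀ {z} → x ⊑ z → z ⊑ w → z ∈ W)

  Component⊆ : ∀ {W x} → Component W x ⊆ W
  Component⊆ (x⊑w , _ , p) = p x⊑w ⊑-refl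

  Component-root : ∀ {W x} → x ∈ T → x ∈ W → x ∈ Component W x
  Component-root {W} x∈T x∈W =
    ⊑-refl , x∈T , λ x⊑z z⊑x → subst W (⊑-antisym x⊑z z⊑x) x∈W

  Component-child : ∀ {W x v c} → v ∈ Component W x → c ∈ Children T v →
                    c ∈ W → c ∈ Component W x
  Component-child {W} (x⊑v , v∈T , p) (c∈T , n , refl) c∈W =
    ⊑-trans x⊑v ⊑-∷ʳ , c∈T , λ x⊑z z⊑c →
      [ p x⊑z , (λ eq → subst W (sym eq) c∈W) ]′ (⊑-∷ʳ⁻ z⊑c)

  Component-subtree : ∀ {W x} → x ∈ T → x ∈ W → Subtree T (Component W x)
  Component-subtree {x = x} x∈T x∈W = proj₁ ∘ proj₂ , record
    { root         = x
    ; root∈        = Component-root x∈T x∈W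
    ; rooted       = proj₁
    ; prefixClosed = λ { (_ , w∈T , p) (σ , refl) →
        let q = σ , sym (++-assoc x _ σ) in
        (_ , refl) , convex isTree x∈T w∈T (_ , refl) q ,
        λ x⊑z z⊑y → p x⊑z (⊑-trans z⊑y q) }
    }

  ν-characterization : ∀ {Z O} (ϑ : Fix AP (suc Z) (suc O)) {χ ξ x} → χ ⊆ᵀ → x ∈ T →
    x ∈ ⟦ 𝒯 ⟧ᶠ (ν ϑ) χ ξ ⇔
    (∃ λ S → Subtree T S × x ∈ S × S ⊆ ⟦ 𝒯 ⟧ᶠ ϑ (S ∷ χ) (S ∷ ξ))
  ν-characterization ϑ {χ} {ξ} {x} χ⊆T x∈T = mk⇔ forth
    λ (S , (S⊆T , _) , x∈S , S⊆) → S , S⊆T , S⊆ , x∈S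
    where
    W : Pred Word 0ℓ
    W = small (⟦ 𝒯 ⟧ᶠ (ν ϑ) χ ξ)

    W-fixed : ⟦ 𝒯 ⟧ᶠ ϑ (W ∷ χ) (W ∷ ξ) ≐ W
    W-fixed = unfold-ν ϑ χ⊆T small≐

    forth : x ∈ ⟦ 𝒯 ⟧ᶠ (ν ϑ) χ ξ →
            ∃ λ S → Subtree T S × x ∈ S × S ⊆ ⟦ 𝒯 ⟧ᶠ ϑ (S ∷ χ) (S ∷ ξ)
    forth r = Component W x , Component-subtree x∈T (fromWitness r) ,
      Component-root x∈T (fromWitness r) ,
      -- The assignment and its bound both start with `W`; only the target assignment has the
      -- component in its place.
      λ v∈S → restrict Component⊆ Component-child ϑ
        (cons-⊆ᵀ (⟦⟧ᶠ⊆T (ν ϑ) χ⊆T ∘ toWitness) χ⊆T) (λ _ → id) (λ _ → id) W-fixed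
        (λ w∈S → cons-≤ (λ _ → w∈S) λ _ → id)
        (λ w∈S c → cons-≤ (Component-child w∈S c) λ _ → id)
        v∈S (proj₂ W-fixed (Component⊆ v∈S))

  μ-characterization : ∀ {Z O} (ϑ : Fix AP (suc Z) (suc O)) {χ ξ x} → χ ⊆ᵀ → x ∈ T →
    x ∈ ⟦ 𝒯 ⟧ᶠ (μ ϑ) χ ξ ⇔
    (¬ ∃ λ S → Subtree T S × x ∈ S × (∀ {v} → v ∈ S → v ∉ ⟦ 𝒯 ⟧ᶠ ϑ (T ∖ S ∷ χ) (T ∖ S ∷ ξ)))
  μ-characterization ϑ {χ} {ξ} {x} χ⊆T x∈T = mk⇔ forth back
    where
    W : Pred Word 0ℓ
    W = small (⟦ 𝒯 ⟧ᶠ (μ ϑ) χ ξ)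

    W-fixed : ⟦ 𝒯 ⟧ᶠ ϑ (W ∷ χ) (W ∷ ξ) ≐ W
    W-fixed = unfold-μ ϑ χ⊆T small≐

    forth : x ∈ ⟦ 𝒯 ⟧ᶠ (μ ϑ) χ ξ →
            ¬ ∃ λ S → Subtree T S × x ∈ S × (∀ {v} → v ∈ S → v ∉ ⟦ 𝒯 ⟧ᶠ ϑ (T ∖ S ∷ χ) (T ∖ S ∷ ξ))
    -- The complement of `S` is a pre-fixpoint, so the least fixpoint misses `S`.
    forth r (S , (S⊆T , _) , x∈S , S∩) = proj₂ (r (T ∖ S) proj₁ λ q →
      ⟦⟧ᶠ⊆T ϑ (cons-⊆ᵀ proj₁ χ⊆T) q , λ v∈S → S∩ v∈S q) x∈S

    back : (¬ ∃ λ S → Subtree T S × x ∈ S × (∀ {v} → v ∈ S → v ∉ ⟦ 𝒯 ⟧ᶠ ϑ (T ∖ S ∷ χ) (T ∖ S ∷ ξ))) →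
           x ∈ ⟦ 𝒯 ⟧ᶠ (μ ϑ) χ ξ
    back none = decidable-stable em λ x∉ →
      let x∈C = x∉ ∘ toWitness in
      -- If `v` in `S` satisfied the body at the complement of `S`, then `extend` would give it at
      -- `W`, putting `v` into `W`, which `S` avoids.
      none (S , Component-subtree x∈T x∈C , Component-root x∈T x∈C , λ v∈S q →
        Component⊆ v∈S (proj₁ W-fixed (extend leaving ϑ
          (cons-⊆ᵀ (⟦⟧ᶠ⊆T (μ ϑ) χ⊆T ∘ toWitness) χ⊆T) (cons-⊆ᵀ proj₁ χ⊆T)
          (λ _ → id) (λ _ → id) W-fixed
          (λ w∈S → cons-≤ (λ (_ , w∉S) → contradiction w∈S w∉S) λ _ → id)
          (λ w∈S c → cons-≤ (λ (_ , c∉S) → leaving w∈S c c∉S) λ _ → id)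
          v∈S q)))
      where
      S : Pred Word 0ℓ
      S = Component (λ w → w ∉ W) x

      leaving : ∀ {v c} → v ∈ S → c ∈ Children T v → c ∉ S → c ∈ W
      leaving v∈S c c∉S = decidable-stable (decide _) λ c∉W →
        c∉S (Component-child v∈S c c∉W)

  -- Correctness of the translation.

  open MTL using (Formula; Sat)
  open Translation {AP}

  child-correct : ∀ {m n} {σ : Assignment n} (ρ : Vec Word m) x y →
    lookup ρ x ∈ T → lookup ρ y ∈ T →
    Sat 𝒯 ρ σ (child x y) ⇔ lookup ρ y ∈ Children T (lookup ρ x)
  child-correct {σ = σ} ρ x y x∈T y∈T = mk⇔ forth back
    where
    forth : Sat 𝒯 ρ σ (child x y) → lookup ρ y ∈ Children T (lookup ρ x)
    forth (lift ([] , eq) , y⋢x , _) = contradiction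
      (lift ([] , trans (sym (trans eq (++-identityʳ _))) (sym (++-identityʳ _)))) y⋢x
    forth (lift (n ∷ τ , eq) , _ , immediate) =
      y∈T , n , ⊑-antisym (decidable-stable (decide _) λ y⋢z → immediate
        (z , z∈T , lift ⊑-∷ʳ , ∷ʳ-⋢ ∘ lower , lift z⊑y , y⋢z ∘ lower)) z⊑y
      where
      -- The child of `x` on the way to `y`. It lies properly below `x`, so if it were properly
      -- above `y` it would be a forbidden intermediate node.
      z : Word
      z = lookup ρ x ∷ʳ n

      z⊑y : z ⊑ lookup ρ y
      z⊑y = τ , trans eq (sym (++-assoc (lookup ρ x) (n ∷ []) τ))

      z∈T : z ∈ T
      z∈T = convex isTree x∈T y∈T ⊑-∷ʳ z⊑y

    back : lookup ρ y ∈ Children T (lookup ρ x) → Sat 𝒯 ρ σ (child x y)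
    back (_ , n , eq) rewrite eq =
      lift ⊑-∷ʳ , ∷ʳ-⋢ ∘ lower ,
      λ (z , _ , _ , z⋢x , lift z⊑y , y⋢z) →
        [ z⋢x ∘ lift , (λ eq → y⋢z (lift (subst (_⊑ z) eq ⊑-refl))) ]′ (⊑-∷ʳ⁻ z⊑y)

  distinctFrom-correct : ∀ {m n} {σ : Assignment n} (ρ : Vec Word m) y zs →
    Sat 𝒯 ρ σ (distinctFrom y zs) ⇔ All (λ z → lookup ρ y ≢ lookup ρ z) zs
  distinctFrom-correct ρ y []       = mk⇔ (λ _ → []) (λ _ → lift ⊑-refl)
  distinctFrom-correct {σ = σ} ρ y (z ∷ zs) = mk⇔
    (λ (y≉z , rest) →
      (λ eq → y≉z (lift (subst (_ ⊑_) eq ⊑-refl) , lift (subst (_⊑ _) eq ⊑-refl)))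
      ∷ to (distinctFrom-correct {σ = σ} ρ y zs) rest)
    (λ { (y≢z ∷ rest) →
      (λ (lift y⊑z , lift z⊑y) → y≢z (⊑-antisym y⊑z z⊑y)) ,
      from (distinctFrom-correct {σ = σ} ρ y zs) rest })

  Fresh : ∀ {m} → Vec Word m → List (Fin m) → Pred Word 0ℓ
  Fresh ρ ys w = All (λ y → w ≢ lookup ρ y) ys

  -- The induction on `k` enlarges both `ρ` and `ys`, so the statement counts only children
  -- different from those already chosen.
  children≥-correct : ∀ {n} {σ : Assignment n}
    (φ : ∀ {m} → Fin m → Formula AP m n) (Q : Pred Word (lsuc 0ℓ)) →
    (∀ {m} (ρ : Vec Word m) y → lookup ρ y ∈ T → Sat 𝒯 ρ σ (φ y) ⇔ lookup ρ y ∈ Q) →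
    ∀ k {m} (ρ : Vec Word m) x ys → lookup ρ x ∈ T →
    Sat 𝒯 ρ σ (children≥ k x ys φ) ⇔
    AtLeast k ((Children T (lookup ρ x) ∩ Q) ∩ Fresh ρ ys)
  children≥-correct φ Q φ≐Q zero ρ x ys x∈T =
    mk⇔ (λ _ → (λ ()) , (λ {}) , λ ()) (λ _ → lift ⊑-refl)
  children≥-correct {σ = σ} φ Q φ≐Q (suc k) ρ x ys x∈T = mk⇔
    (λ (w , w∈T , c , q , fresh , more) → to (AtLeast-suc {P = Here})
      (w , ((to (is-child w w∈T) c , to (φ≐Q (w ∷ ρ) zero w∈T) q) ,
            All.map⁻ (to (is-fresh w) fresh)) ,
       AtLeast-map {P = Rest w} {Q = λ v → v ∈ Here × v ≢ w}
         (λ { (q , v≢w ∷ v-fresh) → (q , All.map⁻ v-fresh) , v≢w }) (to (rest w) more)))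
    (back ∘ from (AtLeast-suc {P = Here}))
    where
    Here : Pred Word (lsuc 0ℓ)
    Here = (Children T (lookup ρ x) ∩ Q) ∩ Fresh ρ ys

    Rest : Word → Pred Word (lsuc 0ℓ)
    Rest w = (Children T (lookup ρ x) ∩ Q) ∩ Fresh (w ∷ ρ) (zero ∷ map suc ys)

    is-child : ∀ w → w ∈ T →
      Sat 𝒯 (w ∷ ρ) σ (child (suc x) zero) ⇔ w ∈ Children T (lookup ρ x)
    is-child w = child-correct {σ = σ} (w ∷ ρ) (suc x) zero x∈T

    is-fresh : ∀ w → Sat 𝒯 (w ∷ ρ) σ (distinctFrom zero (map suc ys)) ⇔
      All (λ y → w ≢ lookup (w ∷ ρ) y) (map suc ys)
    is-fresh w = distinctFrom-correct (w ∷ ρ) zero (map suc ys)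

    rest : ∀ w → Sat 𝒯 (w ∷ ρ) σ (children≥ k (suc x) (zero ∷ map suc ys) φ) ⇔ AtLeast k (Rest w)
    rest w = children≥-correct φ Q φ≐Q k (w ∷ ρ) (suc x) (zero ∷ map suc ys) x∈T

    back : (∃ λ w → w ∈ Here × AtLeast k (λ v → v ∈ Here × v ≢ w)) →
           Sat 𝒯 ρ σ (children≥ (suc k) x ys φ)
    back (w , ((c , q) , fresh) , more) =
      let w∈T = proj₁ c in
      w , w∈T , from (is-child w w∈T) c , from (φ≐Q (w ∷ ρ) zero w∈T) q ,
      from (is-fresh w) (All.map⁺ fresh) ,
      from (rest w) (AtLeast-map {P = λ v → v ∈ Here × v ≢ w} {Q = Rest w}
        (λ ((q , v-fresh) , v≢w) → q , v≢w ∷ All.map⁺ v-fresh) more)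

  ⟪_⟫ : ∀ {n} → SetVar n → Assignment n → Pred Word 0ℓ
  ⟪ Sign.+ , X ⟫ σ = lookup σ X
  ⟪ Sign.- , X ⟫ σ = T ∖ lookup σ X

  infix 9 _[_]
  _[_] : ∀ {Z n} → Vec (SetVar n) Z → Assignment n → Assignment Z
  χ [ σ ] = Vec.map (λ X → ⟪ X ⟫ σ) χ

  []-⊆ᵀ : ∀ {Z n} {σ : Assignment n} → σ ⊆ᵀ → (χ : Vec (SetVar n) Z) → χ [ σ ] ⊆ᵀ
  []-⊆ᵀ σ⊆T ((Sign.+ , X) ∷ χ) zero    = σ⊆T X
  []-⊆ᵀ σ⊆T ((Sign.- , X) ∷ χ) zero    = proj₁
  []-⊆ᵀ σ⊆T (_ ∷ χ)            (suc i) = []-⊆ᵀ σ⊆T χ i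

  weaken-[] : ∀ {Z n S} {σ : Assignment n} (χ : Vec (SetVar n) Z) →
              Vec.map weaken χ [ S ∷ σ ] ≡ χ [ σ ]
  weaken-[] χ = trans (sym (map-∘ _ _ χ))
    (map-cong (λ { (Sign.+ , _) → refl ; (Sign.- , _) → refl }) χ)

  member-correct : ∀ {m n} {ρ : Vec Word m} {σ : Assignment n} {x} → lookup ρ x ∈ T →
    ∀ X → Sat 𝒯 ρ σ (member x X) ⇔ Lift (lsuc 0ℓ) (lookup ρ x ∈ ⟪ X ⟫ σ)
  member-correct x∈T (Sign.+ , X) = mk⇔ id id
  member-correct x∈T (Sign.- , X) = mk⇔
    (λ x∉X → lift (x∈T , x∉X ∘ lift)) (λ (lift (_ , x∉X)) → x∉X ∘ lower)

  mutual
    translate-correct : ∀ {s Z O m n} (φ : Base AP s Z O) {ρ : Vec Word m} {σ : Assignment n} x χ ξ →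
      σ ⊆ᵀ → lookup ρ x ∈ T →
      Sat 𝒯 ρ σ (translate φ x χ ξ) ⇔ lookup ρ x ∈ ⟦ 𝒯 ⟧ φ (χ [ σ ]) (ξ [ σ ])
    translate-correct ff x χ ξ σ⊆T x∈T =
      mk⇔ (λ ⋢ → ⊥-elim (⋢ (lift ⊑-refl))) (λ ())
    translate-correct tt x χ ξ σ⊆T x∈T = mk⇔ (λ _ → lift x∈T) (λ _ → lift ⊑-refl)
    translate-correct (atom a) x χ ξ σ⊆T x∈T =
      mk⇔ (λ (lift a∈) → lift (x∈T , a∈)) (λ (lift (_ , a∈)) → lift a∈)
    translate-correct (neg φ) x χ ξ σ⊆T x∈T =
      let ih = translate-correct φ x χ ξ σ⊆T x∈T in
      mk⇔ (λ r → x∈T , r ∘ from ih) (λ (_ , r) → r ∘ to ih)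
    translate-correct (φ ∧ ψ) x χ ξ σ⊆T x∈T =
      translate-correct φ x χ ξ σ⊆T x∈T ×-⇔ translate-correct ψ x χ ξ σ⊆T x∈T
    translate-correct (φ ∨ ψ) x χ ξ σ⊆T x∈T =
      let ihφ = translate-correct φ x χ ξ σ⊆T x∈T
          ihψ = translate-correct ψ x χ ξ σ⊆T x∈T in
      mk⇔ (λ r → decidable-stable em λ ∉ →
             r ((λ p → ∉ (inj₁ (to ihφ p))) , (λ p → ∉ (inj₂ (to ihψ p)))))
          (λ r (¬p , ¬q) → [ ¬p ∘ from ihφ , ¬q ∘ from ihψ ]′ r)
    translate-correct (◇≥ k φ) {ρ} {σ} x χ ξ σ⊆T x∈T = mk⇔
      (λ r → x∈T , AtLeast-map {P = C ∩ Fresh ρ []} {Q = C} proj₁ (to ih r))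
      (λ (_ , r) → from ih (AtLeast-map {P = C} {Q = C ∩ Fresh ρ []} (_, []) r))
      where
      C = Children T (lookup ρ x) ∩ ⟦ 𝒯 ⟧ φ (ξ [ σ ]) []
      ih = children≥-correct (λ y → translate φ y ξ []) (⟦ 𝒯 ⟧ φ (ξ [ σ ]) [])
        (λ ρ y → translate-correct φ {ρ} y ξ [] σ⊆T) k ρ x [] x∈T
    translate-correct (□< k φ) {ρ} {σ} x χ ξ σ⊆T x∈T = mk⇔
      (λ r → x∈T , λ many → r (from ih (AtLeast-map {P = C} {Q = C ∩ Fresh ρ []} (_, []) many)))
      (λ (_ , few) r → few (AtLeast-map {P = C ∩ Fresh ρ []} {Q = C} proj₁ (to ih r)))
      where
      C = Children T (lookup ρ x) ∖ ⟦ 𝒯 ⟧ φ (ξ [ σ ]) []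
      ih = children≥-correct (λ y → MTL.neg (translate φ y ξ [])) (λ w → w ∉ ⟦ 𝒯 ⟧ φ (ξ [ σ ]) [])
        (λ ρ y y∈T → let ih = translate-correct φ {ρ} y ξ [] σ⊆T y∈T in
          mk⇔ (_∘ from ih) (_∘ to ih))
        k ρ x [] x∈T
    translate-correct (var X) {ρ} {σ} x χ ξ σ⊆T x∈T =
      subst (λ V → Sat 𝒯 ρ σ (member x (lookup χ X)) ⇔ Lift _ (lookup ρ x ∈ V))
        (sym (lookup-map X _ χ)) (member-correct x∈T (lookup χ X))
    translate-correct (closed ϑ) x χ ξ σ⊆T x∈T = translateᶠ-correct ϑ x [] [] σ⊆T x∈T

    translateᶠ-correct : ∀ {Z O m n} (ϑ : Fix AP Z O) {ρ : Vec Word m} {σ : Assignment n} x χ ξ →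
      σ ⊆ᵀ → lookup ρ x ∈ T →
      Sat 𝒯 ρ σ (translateᶠ ϑ x χ ξ) ⇔ lookup ρ x ∈ ⟦ 𝒯 ⟧ᶠ ϑ (χ [ σ ]) (ξ [ σ ])
    translateᶠ-correct (μ ϑ) {ρ} {σ} x χ ξ σ⊆T x∈T = mk⇔ forth back
      where
      char = μ-characterization ϑ {χ [ σ ]} {ξ [ σ ]} ([]-⊆ᵀ σ⊆T χ) x∈T

      χ⁻ = (Sign.- , zero) ∷ Vec.map weaken χ
      ξ⁻ = (Sign.- , zero) ∷ Vec.map weaken ξ

      body : ∀ {S v} → Subtree T S → v ∈ T →
        Sat 𝒯 (v ∷ ρ) (S ∷ σ) (translateᶠ ϑ zero χ⁻ ξ⁻) ⇔
        v ∈ ⟦ 𝒯 ⟧ᶠ ϑ (T ∖ S ∷ χ [ σ ]) (T ∖ S ∷ ξ [ σ ])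
      body {S} {v} (S⊆T , _) v∈T = subst₂
        (λ χ′ ξ′ → Sat 𝒯 (v ∷ ρ) (S ∷ σ) (translateᶠ ϑ zero χ⁻ ξ⁻) ⇔
                   v ∈ ⟦ 𝒯 ⟧ᶠ ϑ (T ∖ S ∷ χ′) (T ∖ S ∷ ξ′))
        (weaken-[] χ) (weaken-[] ξ)
        (translateᶠ-correct ϑ zero χ⁻ ξ⁻ (cons-⊆ᵀ S⊆T σ⊆T) v∈T)

      forth : Sat 𝒯 ρ σ (translateᶠ (μ ϑ) x χ ξ) →
              lookup ρ x ∈ ⟦ 𝒯 ⟧ᶠ (μ ϑ) (χ [ σ ]) (ξ [ σ ])
      forth none = from char λ (S , sub , x∈S , S∩) → none (S , sub , lift x∈S ,
        λ (v , v∈T , lift v∈S , r) → S∩ v∈S (to (body sub v∈T) r))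

      back : lookup ρ x ∈ ⟦ 𝒯 ⟧ᶠ (μ ϑ) (χ [ σ ]) (ξ [ σ ]) →
             Sat 𝒯 ρ σ (translateᶠ (μ ϑ) x χ ξ)
      back r (S , sub , lift x∈S , S∩) = to char r (S , sub , x∈S , λ {v} v∈S q →
        let v∈T = proj₁ sub v∈S in S∩ (v , v∈T , lift v∈S , from (body sub v∈T) q))
    translateᶠ-correct (ν ϑ) {ρ} {σ} x χ ξ σ⊆T x∈T = mk⇔ forth back
      where
      char = ν-characterization ϑ {χ [ σ ]} {ξ [ σ ]} ([]-⊆ᵀ σ⊆T χ) x∈T

      χ⁺ = (Sign.+ , zero) ∷ Vec.map weaken χ
      ξ⁺ = (Sign.+ , zero) ∷ Vec.map weaken ξ

      body : ∀ {S v} → Subtree T S → v ∈ T →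
        Sat 𝒯 (v ∷ ρ) (S ∷ σ) (translateᶠ ϑ zero χ⁺ ξ⁺) ⇔
        v ∈ ⟦ 𝒯 ⟧ᶠ ϑ (S ∷ χ [ σ ]) (S ∷ ξ [ σ ])
      body {S} {v} (S⊆T , _) v∈T = subst₂
        (λ χ′ ξ′ → Sat 𝒯 (v ∷ ρ) (S ∷ σ) (translateᶠ ϑ zero χ⁺ ξ⁺) ⇔
                   v ∈ ⟦ 𝒯 ⟧ᶠ ϑ (S ∷ χ′) (S ∷ ξ′))
        (weaken-[] χ) (weaken-[] ξ)
        (translateᶠ-correct ϑ zero χ⁺ ξ⁺ (cons-⊆ᵀ S⊆T σ⊆T) v∈T)

      forth : Sat 𝒯 ρ σ (translateᶠ (ν ϑ) x χ ξ) →
              lookup ρ x ∈ ⟦ 𝒯 ⟧ᶠ (ν ϑ) (χ [ σ ]) (ξ [ σ ])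
      forth (S , sub , lift x∈S , S⊆) = from char (S , sub , x∈S , λ {v} v∈S →
        let v∈T = proj₁ sub v∈S in
        to (body sub v∈T) (decidable-stable em λ ¬r → S⊆ (v , v∈T , lift v∈S , ¬r)))

      back : lookup ρ x ∈ ⟦ 𝒯 ⟧ᶠ (ν ϑ) (χ [ σ ]) (ξ [ σ ]) →
             Sat 𝒯 ρ σ (translateᶠ (ν ϑ) x χ ξ)
      back r with to char r
      ... | S , sub , x∈S , S⊆ = S , sub , lift x∈S ,
        λ (v , v∈T , lift v∈S , ¬r) → ¬r (from (body sub v∈T) (S⊆ v∈S))
    translateᶠ-correct (base φ) x χ ξ σ⊆T x∈T = translate-correct φ x χ ξ σ⊆T x∈T

  translateSentence-correct : (ϑ : Sentence AP) →
    𝒯 OSGMC.⊨ ϑ ⇔ 𝒯 MTL.⊨ translateSentence ϑ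
  translateSentence-correct ϑ = mk⇔
    (λ r → root , root∈ ,
      (λ (_ , w∈T , root⋢w) → root⋢w (lift (rooted w∈T))) , from (body root∈) r)
    (λ (w , w∈T , minimal , r) →
      -- The first conjunct makes `w` a prefix of the root, and the root is a prefix of every node.
      let w≡root = ⊑-antisym
            (decidable-stable (decide _) λ w⋢ → minimal (root , root∈ , w⋢ ∘ lower))
            (rooted w∈T) in
      subst (_∈ ⟦ 𝒯 ⟧ᶠ ϑ [] []) w≡root (to (body w∈T) r))
    where
    open IsTree isTree using (root∈; rooted)
    body : ∀ {w} → w ∈ T → Sat 𝒯 (w ∷ []) [] (translateᶠ ϑ zero [] []) ⇔ w ∈ ⟦ 𝒯 ⟧ᶠ ϑ [] []
    body w∈T = translateᶠ-correct ϑ zero [] [] (λ ()) w∈T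

theorem10 : ExcludedMiddle (lsuc 0ℓ) → (AP : Set) → Finite AP →
    (ϑ : OSGMC.Sentence AP) → ∃ λ (ψ : MTL.Sentence AP) → Equivalent ϑ ψ
theorem10 em AP _ ϑ = Translation.translateSentence ϑ ,
  λ 𝒯 → Semantics.translateSentence-correct em 𝒯 ϑ
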